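{- Let $\dagger : \mathbb{G}(P)\times \mathcal{L}_0(P) \rightarrow \mathbb{G}(P)$ be a relevant P-graph transformation. Suppose that for every P-graph $G = \langle \Phi, \prec\rangle$ and every propositional formula $\varphi \in \mathcal{L}_0(P)$, the P-graph $\dagger(G,\varphi)= \langle \Phi_\dagger, \prec_\dagger\rangle$ satisfies both of the following conditions. 1. For all $\xi \in \Phi$ there is some $\xi' \in \Phi_\dagger$ such that (a) $\varphi \wedge \xi \equiv \varphi \wedge \xi'$, and (b) for all $\psi' \in \Phi_\dagger$, if $\psi' \prec_\dagger \xi'$ then either $\psi'\equiv \varphi$, or there is $\psi \in \Phi$ such that $\varphi \wedge \psi \equiv \varphi \wedge \psi'$ and $\psi\prec \xi$. 2. For all $\xi \in \Phi_\dagger$, either $\xi \equiv \varphi$, or there is some $\xi' \in \Phi$ such that (a) $\varphi \wedge \xi \equiv \varphi \wedge \xi'$, and (b) for all $\psi' \in \Phi$, if $\psi' \prec \xi'$ then there is $\psi \in \Phi_\dagger$ such that $\varphi \wedge \psi \equiv \varphi \wedge \psi'$ and $\psi\prec_\dagger \xi$. Then $\dagger$ satisfies DP-1; that is, every dynamic operator $\star$ induced by $\dagger$ satisfies DP-1: for every preference model $M=\langle W,\leq,v\rangle$ and every $\varphi\in\mathcal{L}_0(P)$, writing $\star(M,\varphi)=\langle W,\leq_{\star\varphi},v\rangle$, and for all $w,w'\in W$: if $w\vDash\varphi$ and $w'\vDash\varphi$, then $w\leq_{\star\varphi} w'$ if and only if $w\leq w'$.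
   Context: $P$ is a countable set of propositional symbols and $\mathcal{L}_0(P)$ is the set of classical propositional formulas over $P$; $\equiv$ is classical logical equivalence. P-graph: a pair $G=\langle\Phi,\prec\rangle$ with $\Phi\subseteq\mathcal{L}_0(P)$ and $\prec$ a strict partial order on $\Phi$. $\mathbb{G}(P)$ is the set of all P-graphs over $P$. Given a non-empty set $W$ of worlds and a valuation $v:P\to 2^W$, $w\vDash\varphi$ denotes classical satisfaction of $\varphi$ at $w$ (with $w\vDash p$ iff $w\in v(p)$). The relation $\leq_G$ on $W$ is: $w\leq_G w'$ iff for every $\varphi\in\Phi$, either ($w'\vDash\varphi$ implies $w\vDash\varphi$), or there is $\psi\in\Phi$ with $\psi\prec\varphi$, $w\vDash\psi$ and $w'\not\vDash\psi$. Preference model: $M=\langle W,\leq,v\rangle$ with $W$ a non-empty set, $v:P\to 2^W$, and $\leq$ a reflexive transitive relation on $W$ whose strict part $<$ ($w<w'$ iff $w\leq w'$ and not $w'\leq w$) is well-founded. $M$ is induced by a P-graph $G$ iff $\leq\;=\;\leq_G$ (computed with $W$ and $v$). Dynamic operator: a function $\star$ mapping each pair (preference model $\langle W,\leq,v\rangle$, formula $\varphi\in\mathcal{L}_0(P)$) to a preference model $\langle W,\leq_{\star\varphi},v\rangle$ with the same $W$ and $v$. P-graph transformation: any function $\dagger:\mathbb{G}(P)\times\mathcal{L}_0(P)\to\mathbb{G}(P)$. A dynamic operator $\star$ is induced by $\dagger$ if for all preference models $M$, P-graphs $G$ and formulas $\varphi\in\mathcal{L}_0(P)$: if $M$ is induced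 by $G$ then $\star(M,\varphi)$ is induced by $\dagger(G,\varphi)$. $\dagger$ is relevant if some dynamic operator is induced by it. $\dagger$ satisfies a postulate if $\dagger$ is relevant and every dynamic operator induced by $\dagger$ satisfies the postulate.
   Formalization: DP-1 is proved only for preference models induced by some P-graph, not for every preference model; the literal claim fails for the identity transformation, since an induced operator is unconstrained on models that no P-graph induces. -}

module Defs where

open import Level using (0ℓ; suc)
open import Data.Bool using (Bool; true; false; not; T) renaming (_∧_ to _&&_; _∨_ to _||_)
open import Data.Nat using (ℕ)
open import Data.Product using (∃-syntax; _×_)
open import Data.Sum using (_⊎_)
open import Function.Bundles using (_↣_; _⇔_)
open import Induction.WellFounded using (WellFounded)
open import Relation.Binary using (Rel; Reflexive; Transitive; IsStrictPartialOrder)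
open import Relation.Binary.PropositionalEquality using (_≡_)
open import Relation.Nullary using (¬_)
open import Relation.Unary using (Pred; _∈_)

infix  10 ~_
infixr 9 _∧_
infixr 8 _∨_
infixr 7 _⇒_
infix  4 _≣_ _,_⊨_ _InducedBy_ _OperatorInducedBy_ _Satisfies_

-- Finite sets count as countable.
Countable : Set → Set
Countable P = P ↣ ℕ

data Formula (P : Set) : Set where
  var     : P → Formula P
  ⊤′ ⊥′   : Formula P
  ~_      : Formula P → Formula P
  _∧_ _∨_ _⇒_ : Formula P → Formula P → Formula P

eval : {P : Set} → (P → Bool) → Formula P → Bool
eval σ (var p) = σ p
eval σ ⊤′      = true
eval σ ⊥′      = false
eval σ (~ φ)   = not (eval σ φ)
eval σ (φ ∧ ψ) = eval σ φ && eval σ ψ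
eval σ (φ ∨ ψ) = eval σ φ || eval σ ψ
eval σ (φ ⇒ ψ) = not (eval σ φ) || eval σ ψ

_≣_ : {P : Set} → Rel (Formula P) 0ℓ
φ ≣ ψ = ∀ σ → eval σ φ ≡ eval σ ψ

-- The elements of 2^W are rendered as W → Bool, so that satisfaction is
-- classical without assuming excluded middle.
Valuation : Set → Set → Set
Valuation P W = P → W → Bool

_,_⊨_ : {P W : Set} → Valuation P W → W → Formula P → Set
v , w ⊨ φ = T (eval (λ p → v p w) φ)

-- ≺ is a relation on Φ, presented as a relation on all formulas that is
-- contained in Φ × Φ; the order is with respect to syntactic identity.
record PGraph (P : Set) : Set₁ where
  field
    Φ                    : Pred (Formula P) 0ℓ
    _≺_                  : Rel (Formula P) 0ℓ
    ≺⊆Φ×Φ                : ∀ {φ ψ} → φ ≺ ψ → φ ∈ Φ × ψ ∈ Φ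
    isStrictPartialOrder : IsStrictPartialOrder _≡_ _≺_

Strict : {W : Set} → Rel W 0ℓ → Rel W 0ℓ
Strict _≤_ w w′ = w ≤ w′ × ¬ (w′ ≤ w)

record PreferenceOrder (W : Set) : Set₁ where
  field
    _≤_         : Rel W 0ℓ
    reflexive   : Reflexive _≤_
    transitive  : Transitive _≤_
    wellFounded : WellFounded (Strict _≤_)

record PreferenceModel (P : Set) : Set₁ where
  field
    W        : Set
    nonEmpty : W
    v        : Valuation P W
    order    : PreferenceOrder W

  open PreferenceOrder order public

graphOrder : {P W : Set} → PGraph P → Valuation P W → Rel W 0ℓ
graphOrder G v w w′ =
  ∀ φ → φ ∈ Φ →
    (v , w′ ⊨ φ → v , w ⊨ φ)
    ⊎ (∃[ ψ ] (ψ ∈ Φ × ψ ≺ φ × v , w ⊨ ψ × ¬ (v , w′ ⊨ ψ)))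
  where open PGraph G

_InducedBy_ : {P : Set} → PreferenceModel P → PGraph P → Set
M InducedBy G = ∀ w w′ → (w ≤ w′) ⇔ graphOrder G v w w′
  where open PreferenceModel M

-- Only the new order is returned, since W and v are kept.
DynamicOperator : Set → Set₁
DynamicOperator P =
  (M : PreferenceModel P) → Formula P → PreferenceOrder (PreferenceModel.W M)

update : {P : Set} → DynamicOperator P → PreferenceModel P → Formula P → PreferenceModel P
update ★ M φ = record
  { W = W ; nonEmpty = nonEmpty ; v = v ; order = ★ M φ }
  where open PreferenceModel M

Transformation : Set → Set₁
Transformation P = PGraph P → Formula P → PGraph P

_OperatorInducedBy_ : {P : Set} → DynamicOperator P → Transformation P → Set₁
★ OperatorInducedBy † =
  ∀ M G φ → M InducedBy G → update ★ M φ InducedBy † G φ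

Relevant : {P : Set} → Transformation P → Set₁
Relevant † = ∃[ ★ ] (★ OperatorInducedBy †)

Postulate : Set → Set₂
Postulate P = DynamicOperator P → Set₁

_Satisfies_ : {P : Set} → Transformation P → Postulate P → Set₁
† Satisfies X = Relevant † × (∀ ★ → ★ OperatorInducedBy † → X ★)

-- DP-1 for the models in the class 𝒞.
DP1-on : {P : Set} → Pred (PreferenceModel P) (suc 0ℓ) → Postulate P
DP1-on 𝒞 ★ =
  ∀ M → M ∈ 𝒞 → ∀ φ → let open PreferenceModel M in
  ∀ w w′ → v , w ⊨ φ → v , w′ ⊨ φ →
  PreferenceOrder._≤_ (★ M φ) w w′ ⇔ (w ≤ w′)

-- "★ is induced by †" says nothing about ★ on models outside this class, for
-- instance a two-world model with w < w′ where w and w′ satisfy the same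
-- symbols. On such models ★ may return the total relation, so DP-1 over the
-- class of all models fails even for the identity transformation.
GraphInduced : {P : Set} → Pred (PreferenceModel P) (suc 0ℓ)
GraphInduced M = ∃[ G ] (M InducedBy G)

Condition1 : {P : Set} → PGraph P → Formula P → PGraph P → Set
Condition1 G φ G† =
  ∀ ξ → ξ ∈ Φ →
  ∃[ ξ′ ] (ξ′ ∈ Φ† × φ ∧ ξ ≣ φ ∧ ξ′ ×
    (∀ ψ′ → ψ′ ∈ Φ† → ψ′ ≺† ξ′ →
      ψ′ ≣ φ ⊎ (∃[ ψ ] (ψ ∈ Φ × φ ∧ ψ ≣ φ ∧ ψ′ × ψ ≺ ξ))))
  where
  open PGraph G
  open PGraph G† using () renaming (Φ to Φ†; _≺_ to _≺†_)

Condition2 : {P : Set} → PGraph P → Formula P → PGraph P → Set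
Condition2 G φ G† =
  ∀ ξ → ξ ∈ Φ† →
  ξ ≣ φ ⊎
  (∃[ ξ′ ] (ξ′ ∈ Φ × φ ∧ ξ ≣ φ ∧ ξ′ ×
    (∀ ψ′ → ψ′ ∈ Φ → ψ′ ≺ ξ′ →
      ∃[ ψ ] (ψ ∈ Φ† × φ ∧ ψ ≣ φ ∧ ψ′ × ψ ≺† ξ))))
  where
  open PGraph G
  open PGraph G† using () renaming (Φ to Φ†; _≺_ to _≺†_)

{-# OPTIONS --safe #-}
-- Two φ-worlds are not told apart by φ, and each of them gives the same truth
-- value to ξ and ξ′ when φ ∧ ξ ≣ φ ∧ ξ′. So the formulas matched by the two
-- conditions compare φ-worlds in the same way, and copies of φ are irrelevant.
module Submission where

open import Defs
open import Data.Bool using (true; T) renaming (_∧_ to _&&_)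
open import Data.Product using (_×_; _,_; proj₁; proj₂)
open import Data.Sum using (inj₁; inj₂)
open import Function using (_∘_)
open import Function.Bundles using (_⇔_; mk⇔; module Equivalence)
open import Function.Construct.Composition using (_⇔-∘_)
open import Function.Construct.Symmetry using (⇔-sym)
open import Relation.Binary.PropositionalEquality using (_≡_; sym; subst)
open import Relation.Nullary using (contradiction)

open Equivalence using (to; from)

-- `T false` is empty, so only `a = true` is left, where both conjunctions reduce to their second
-- factors.
&&-cancelˡ : ∀ {a b c} → T a → a && b ≡ a && c → b ≡ c
&&-cancelˡ {true} _ eq = eq

module _ {P W : Set} (v : Valuation P W) where

  ⊨-resp-≣ : ∀ w ξ ξ′ → ξ ≣ ξ′ → v , w ⊨ ξ → v , w ⊨ ξ′
  ⊨-resp-≣ w ξ ξ′ ξ≣ξ′ = subst T (ξ≣ξ′ (λ p → v p w))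

  ∧-≣⇒⊨⇔ : ∀ w φ ξ ξ′ → v , w ⊨ φ → φ ∧ ξ ≣ φ ∧ ξ′ → v , w ⊨ ξ ⇔ v , w ⊨ ξ′
  ∧-≣⇒⊨⇔ w φ ξ ξ′ w⊨φ φ∧ξ≣φ∧ξ′ = mk⇔ (subst T ξ≡ξ′) (subst T (sym ξ≡ξ′))
    where
    ξ≡ξ′ : eval (λ p → v p w) ξ ≡ eval (λ p → v p w) ξ′
    ξ≡ξ′ = &&-cancelˡ w⊨φ (φ∧ξ≣φ∧ξ′ (λ p → v p w))

  module _ (G G† : PGraph P) (φ : Formula P) (w w′ : W)
           (w⊨φ : v , w ⊨ φ) (w′⊨φ : v , w′ ⊨ φ) where

    private
      at-w : ∀ ξ ξ′ → φ ∧ ξ ≣ φ ∧ ξ′ → v , w ⊨ ξ ⇔ v , w ⊨ ξ′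
      at-w ξ ξ′ = ∧-≣⇒⊨⇔ w φ ξ ξ′ w⊨φ

      at-w′ : ∀ ξ ξ′ → φ ∧ ξ ≣ φ ∧ ξ′ → v , w′ ⊨ ξ ⇔ v , w′ ⊨ ξ′
      at-w′ ξ ξ′ = ∧-≣⇒⊨⇔ w′ φ ξ ξ′ w′⊨φ

    -- The new order is tested at the counterpart `ξ′` of `ξ`; a compensating formula below `ξ′` is
    -- then pulled back to one below `ξ`.
    condition1⇒graphOrder : Condition1 G φ G† →
                            graphOrder G† v w w′ → graphOrder G v w w′
    condition1⇒graphOrder c₁ w≤†w′ ξ ξ∈Φ with c₁ ξ ξ∈Φ
    ... | ξ′ , ξ′∈Φ† , ξ~ξ′ , below with w≤†w′ ξ′ ξ′∈Φ†
    ... | inj₁ imp = inj₁ (from (at-w ξ ξ′ ξ~ξ′) ∘ imp ∘ to (at-w′ ξ ξ′ ξ~ξ′))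
    ... | inj₂ (ψ′ , ψ′∈Φ† , ψ′≺†ξ′ , w⊨ψ′ , w′⊭ψ′) with below ψ′ ψ′∈Φ† ψ′≺†ξ′
    -- A copy of `φ` holds at `w′`, so it cannot compensate.
    ... | inj₁ ψ′≣φ = contradiction (⊨-resp-≣ w′ φ ψ′ (sym ∘ ψ′≣φ) w′⊨φ) w′⊭ψ′
    ... | inj₂ (ψ , ψ∈Φ , ψ~ψ′ , ψ≺ξ) =
      inj₂ (ψ , ψ∈Φ , ψ≺ξ , from (at-w ψ ψ′ ψ~ψ′) w⊨ψ′ ,
            w′⊭ψ′ ∘ to (at-w′ ψ ψ′ ψ~ψ′))

    -- The same transfer with the two graphs exchanged, except that copies of `φ` now occur among
    -- the formulas to be tested, not among the compensating ones.
    condition2⇒graphOrder : Condition2 G φ G† →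
                            graphOrder G v w w′ → graphOrder G† v w w′
    condition2⇒graphOrder c₂ w≤w′ ξ ξ∈Φ† with c₂ ξ ξ∈Φ†
    -- Here `ξ` holds at `w` outright, whatever its value at `w′`.
    ... | inj₁ ξ≣φ = inj₁ λ _ → ⊨-resp-≣ w φ ξ (sym ∘ ξ≣φ) w⊨φ
    ... | inj₂ (ξ′ , ξ′∈Φ , ξ~ξ′ , below) with w≤w′ ξ′ ξ′∈Φ
    ... | inj₁ imp = inj₁ (from (at-w ξ ξ′ ξ~ξ′) ∘ imp ∘ to (at-w′ ξ ξ′ ξ~ξ′))
    ... | inj₂ (ψ′ , ψ′∈Φ , ψ′≺ξ′ , w⊨ψ′ , w′⊭ψ′) with below ψ′ ψ′∈Φ ψ′≺ξ′
    ... | ψ , ψ∈Φ† , ψ~ψ′ , ψ≺†ξ =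
      inj₂ (ψ , ψ∈Φ† , ψ≺†ξ , from (at-w ψ ψ′ ψ~ψ′) w⊨ψ′ ,
            w′⊭ψ′ ∘ to (at-w′ ψ ψ′ ψ~ψ′))

proposition11 : (P : Set) → Countable P →
    († : Transformation P) → Relevant † →
    (∀ G φ → Condition1 G φ († G φ) × Condition2 G φ († G φ)) →
    † Satisfies DP1-on GraphInduced
proposition11 P _ † relevant conditions = relevant , dp1
  where
  dp1 : ∀ ★ → ★ OperatorInducedBy † → DP1-on GraphInduced ★
  dp1 ★ induced M (G , M-by-G) φ w w′ w⊨φ w′⊨φ =
    -- From right to left: the updated order is the graph order of `† G φ`, which agrees with that
    -- of `G` on these two worlds, which in turn is the order of `M`.
    ⇔-sym (M-by-G w w′) ⇔-∘ (orders ⇔-∘ induced M G φ M-by-G w w′)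
    where
    open PreferenceModel M using (v)
    orders : graphOrder († G φ) v w w′ ⇔ graphOrder G v w w′
    orders = mk⇔
      (condition1⇒graphOrder v G († G φ) φ w w′ w⊨φ w′⊨φ (proj₁ (conditions G φ)))
      (condition2⇒graphOrder v G († G φ) φ w w′ w⊨φ w′⊨φ (proj₂ (conditions G φ)))
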